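{- Let $n$ and $t$ be positive integers with $t>\frac{1}{3}n^2+\frac{44}{9}n$, and let $C_t$ be the cycle on $t$ vertices. Then $f_{C_t}(n,n)=n$; that is, every collection of $n$ (not necessarily distinct) independent $n$-sets of $C_t$ has a rainbow independent $n$-set (and fewer than $n$ sets do not suffice).
   Context: For a collection $\mathcal{F}=(F_1,\dots,F_k)$ of sets (not necessarily distinct), a rainbow set of $\mathcal{F}$ is a set $\{x_{i_1},\dots,x_{i_m}\}$ of $m$ distinct elements with $i_1<\dots<i_m$ distinct indices in $[k]$ and $x_{i_j}\in F_{i_j}$. Given a graph $G$ and a collection $\mathcal{F}$ of independent sets of $G$, a rainbow independent set of $(\mathcal{F},G)$ is a rainbow set of $\mathcal{F}$ that is also independent in $G$; an $m$-set is a set of size $m$. For $m\le n$, $f_G(n,m)$ is the minimal number $k$ such that every collection of $k$ independent $n$-sets of $G$ has a rainbow independent $m$-set. -}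

module Defs where

open import Data.Nat using (ℕ; zero; suc; _<_)
open import Data.Fin using (Fin; toℕ)
open import Data.Fin.Subset using (Subset; _∈_; ∣_∣)
open import Data.Product using (Σ; _×_; ∃)
open import Data.Sum using (_⊎_)
open import Function.Definitions using (Injective)
open import Relation.Binary.PropositionalEquality using (_≡_)
open import Relation.Nullary using (¬_)

Graph : ℕ → Set₁
Graph t = Fin t → Fin t → Set

CycleSucc : {t : ℕ} → Fin t → Fin t → Set
CycleSucc {t} i j = (suc (toℕ i) < t × toℕ j ≡ suc (toℕ i))
                  ⊎ (suc (toℕ i) ≡ t × toℕ j ≡ 0)

Cycle : (t : ℕ) → Graph t
Cycle t i j = CycleSucc i j ⊎ CycleSucc j i

Independent : {t : ℕ} → Graph t → Subset t → Set
Independent G S = ∀ x y → x ∈ S → y ∈ S → ¬ G x y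

IndependentNSet : {t : ℕ} → Graph t → ℕ → Subset t → Set
IndependentNSet G n S = Independent G S × ∣ S ∣ ≡ n

HasRainbowIndependent : {t k : ℕ} → Graph t → (Fin k → Subset t) → ℕ → Set
HasRainbowIndependent {t} {k} G F m =
  Σ (Fin m → Fin k) λ σ → Σ (Fin m → Fin t) λ x →
    Injective _≡_ _≡_ σ × Injective _≡_ _≡_ x ×
    (∀ j → x j ∈ F (σ j)) ×
    (∀ j j′ → ¬ G (x j) (x j′))

RainbowProperty : {t : ℕ} → Graph t → ℕ → ℕ → ℕ → Set
RainbowProperty {t} G n m k =
  (F : Fin k → Subset t) → (∀ i → IndependentNSet G n (F i)) →
  HasRainbowIndependent G F m

fEquals : {t : ℕ} → Graph t → ℕ → ℕ → ℕ → Set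
fEquals G n m k = RainbowProperty G n m k × (∀ k′ → k′ < k → ¬ RainbowProperty G n m k′)

{-# OPTIONS --safe #-}
module Submission where

-- If some vertex lies in no set, cut the cycle there and repeatedly take the first occurring
-- vertex of the resulting path: each step costs every other set at most one element.
-- Otherwise choose two centres u and v in different sets such that no set has more than two
-- elements in N[u] ∪ N[v]; the remaining n − 2 sets keep at least n − 2 elements on the rest, where
-- the greedy choice finishes. Such a pair exists by double counting. Give the ordered pair (u , v) the
-- weight Σ_j |F_j ∩ N[u]| |F_j ∩ N[v]| + 2 [u, v ∈ F_j], with total 11 n³. When t² > 11 n³ / 2
-- some pair has weight at most 1; then each set has at most two elements in N[u] ∪ N[v], no set
-- contains both, and u and v are not adjacent, as an edge between different sets has weight at least 2.

open import Defs
open import Data.Nat using (ℕ; _+_; _*_; _<_; _≤_)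
open import Data.Nat using (zero; suc; z≤n; s≤s; s≤s⁻¹; _≟_; _<?_)
open import Data.Nat.Properties
open import Data.Nat.DivMod
  using (_%_; _/_; _mod_; m%n<n; m≡m%n+[m/n]*n; [m+kn]%n≡m%n; [m+n]%n≡m%n; m<n⇒m%n≡m; n%n≡0)
open import Data.Nat.Divisibility using (_∣_; divides; ∣m+n∣m⇒∣n; >⇒∤)
open import Data.Nat.Tactic.RingSolver using (solve-∀)
open import Algebra.Properties.CommutativeMonoid.Sum +-0-commutativeMonoid
  using (sum; sum-remove; ∑-distrib-+; sum-replicate-zero)
open import Data.Bool using (Bool; true; false)
open import Data.Bool.Properties using () renaming (_≟_ to _≟ᵇ_)
open import Data.Empty using (⊥; ⊥-elim)
open import Data.Fin using (Fin; zero; suc; toℕ; punchIn; punchOut)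
open import Data.Fin.Properties
  using (any?; punchIn-injective; punchInᵢ≢i; punchIn-punchOut; toℕ-fromℕ<; fromℕ<-cong;
         fromℕ<-toℕ; toℕ<n; injective⇒≤)
  renaming (_≟_ to _≟ᶠ_)
open import Data.Fin.Subset using (Subset; _∈_; ∣_∣) renaming (⊥ to ∅)
open import Data.Fin.Subset.Properties using (∣⊥∣≡0; ∉⊥)
open import Data.Product using (_×_; _,_; proj₁; proj₂; ∃)
open import Data.Sum using (_⊎_; inj₁; inj₂; [_,_]′; swap)
open import Data.Vec using ([]; _∷_; lookup; here; there)
open import Data.Vec.Properties using (lookup⇒[]=)
open import Function using (_∘_)
open import Function.Definitions using (Injective)
open import Relation.Binary.PropositionalEquality
  using (_≡_; _≢_; refl; sym; trans; cong; cong₂; subst; ≢-sym; module ≡-Reasoning)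
open import Relation.Nullary using (¬_; yes; no; contradiction)

-- Sums over intervals of ℕ

sumFrom : (ℕ → ℕ) → ℕ → ℕ → ℕ
sumFrom f s zero    = 0
sumFrom f s (suc T) = f s + sumFrom f (suc s) T

sumFrom-cong : ∀ {f g} → (∀ p → f p ≡ g p) → ∀ s T → sumFrom f s T ≡ sumFrom g s T
sumFrom-cong f≗g s zero    = refl
sumFrom-cong f≗g s (suc T) = cong₂ _+_ (f≗g s) (sumFrom-cong f≗g (suc s) T)

sumFrom-+ : ∀ f g s T → sumFrom (λ p → f p + g p) s T ≡ sumFrom f s T + sumFrom g s T
sumFrom-+ f g s zero    = refl
sumFrom-+ f g s (suc T) = trans
  (cong (f s + g s +_) (sumFrom-+ f g (suc s) T))
  (interchange (f s) (g s) _ _)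
  where
  interchange : ∀ a b c d → a + b + (c + d) ≡ a + c + (b + d)
  interchange = solve-∀

sumFrom-*ˡ : ∀ c f s T → sumFrom (λ p → c * f p) s T ≡ c * sumFrom f s T
sumFrom-*ˡ c f s zero    = sym (*-zeroʳ c)
sumFrom-*ˡ c f s (suc T) = trans
  (cong (c * f s +_) (sumFrom-*ˡ c f (suc s) T))
  (sym (*-distribˡ-+ c (f s) _))

sumFrom-*ʳ : ∀ c f s T → sumFrom (λ p → f p * c) s T ≡ sumFrom f s T * c
sumFrom-*ʳ c f s zero    = refl
sumFrom-*ʳ c f s (suc T) = trans
  (cong (f s * c +_) (sumFrom-*ʳ c f (suc s) T))
  (sym (*-distribʳ-+ c (f s) _))

sumFrom-shift : ∀ f s T → sumFrom (f ∘ suc) s T ≡ sumFrom f (suc s) T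
sumFrom-shift f s zero    = refl
sumFrom-shift f s (suc T) = cong (f (suc s) +_) (sumFrom-shift f (suc s) T)

sumFrom-last : ∀ f s T → sumFrom f s (suc T) ≡ sumFrom f s T + f (s + T)
sumFrom-last f s zero    = trans (+-identityʳ (f s)) (cong f (sym (+-identityʳ s)))
sumFrom-last f s (suc T) = begin
  f s + sumFrom f (suc s) (suc T)           ≡⟨ cong (f s +_) (sumFrom-last f (suc s) T) ⟩
  f s + (sumFrom f (suc s) T + f (suc s + T)) ≡⟨ +-assoc (f s) _ _ ⟨
  sumFrom f s (suc T) + f (suc s + T)       ≡⟨ cong (λ p → sumFrom f s (suc T) + f p) (+-suc s T) ⟨
  sumFrom f s (suc T) + f (s + suc T)       ∎
  where open ≡-Reasoning

-- Moving the window one step drops `f s` and gains `f (s + t)`, which are equal.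
sumFrom-periodic : ∀ f t → (∀ p → f (p + t) ≡ f p) → ∀ s → sumFrom f s t ≡ sumFrom f 0 t
sumFrom-periodic f t per zero    = refl
sumFrom-periodic f t per (suc s) = trans
  (+-cancelˡ-≡ (f s) _ _ (begin
    f s + sumFrom f (suc s) t ≡⟨ sumFrom-last f s t ⟩
    sumFrom f s t + f (s + t) ≡⟨ cong (sumFrom f s t +_) (per s) ⟩
    sumFrom f s t + f s       ≡⟨ +-comm _ (f s) ⟩
    f s + sumFrom f s t       ∎))
  (sumFrom-periodic f t per s)
  where open ≡-Reasoning

sumFrom-sum : ∀ {n} (g : ℕ → Fin n → ℕ) s T →
  sumFrom (λ p → sum (g p)) s T ≡ sum (λ j → sumFrom (λ p → g p j) s T)
sumFrom-sum {n} g s zero    = sym (sum-replicate-zero n)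
sumFrom-sum {n} g s (suc T) = trans
  (cong (sum (g s) +_) (sumFrom-sum g (suc s) T))
  (sym (∑-distrib-+ (g s) (λ j → sumFrom (λ p → g p j) (suc s) T)))

-- Averaging: a first term that is at least `c` leaves a tail still short of its share.
sumFrom<⇒∃< : ∀ f c s T → sumFrom f s T < T * c →
  ∃ λ p → s ≤ p × p < s + T × f p < c
sumFrom<⇒∃< f c s zero    ()
sumFrom<⇒∃< f c s (suc T) small with f s <? c
... | yes fs<c = s , ≤-refl , m<m+n s (s≤s z≤n) , fs<c
... | no  fs≮c with sumFrom<⇒∃< f c (suc s) T
                      (+-cancelˡ-< c _ _ (≤-<-trans (+-monoˡ-≤ _ (≮⇒≥ fs≮c)) small))
...   | p , s<p , p<hi , fp<c = p , <⇒≤ s<p , subst (p <_) (sym (+-suc s T)) p<hi , fp<c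

sum-const : ∀ {n} (f : Fin n → ℕ) c → (∀ j → f j ≡ c) → sum f ≡ n * c
sum-const {zero}  f c eq = refl
sum-const {suc n} f c eq = cong₂ _+_ (eq zero) (sum-const (f ∘ suc) c (eq ∘ suc))

term≤sum : ∀ {n} (f : Fin n → ℕ) j → f j ≤ sum f
term≤sum {suc n} f j = ≤-trans (m≤m+n (f j) _) (≤-reflexive (sym (sum-remove f)))

two-terms≤sum : ∀ {n} (f : Fin n → ℕ) {i j} → i ≢ j → f i + f j ≤ sum f
two-terms≤sum {suc n} f {i} {j} i≢j = begin
  f i + f j                             ≡⟨ cong (λ l → f i + f l) (punchIn-punchOut i≢j) ⟨
  f i + f (punchIn i (punchOut i≢j))    ≤⟨ +-monoʳ-≤ (f i) (term≤sum (f ∘ punchIn i) (punchOut i≢j)) ⟩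
  f i + sum (f ∘ punchIn i)             ≡⟨ sum-remove f ⟨
  sum f                                 ∎
  where open ≤-Reasoning

-- The total over one period. Quantifying over every start `s` makes it stable under shifts and lets
-- the inner window of a double sum begin at the outer variable.
record WindowSum (t : ℕ) (f : ℕ → ℕ) (M : ℕ) : Set where
  constructor windowSum
  field total : ∀ s → sumFrom f s t ≡ M

open WindowSum

windowSum-shift : ∀ {t f M} → WindowSum t f M → WindowSum t (f ∘ suc) M
windowSum-shift {t} {f} w .total s = trans (sumFrom-shift f s t) (w .total (suc s))

windowSum-+ : ∀ {t f g M N} → WindowSum t f M → WindowSum t g N →
  WindowSum t (λ p → f p + g p) (M + N)
windowSum-+ {t} {f} {g} v w .total s =
  trans (sumFrom-+ f g s t) (cong₂ _+_ (v .total s) (w .total s))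

windowSum-product : ∀ {t f g M N} → WindowSum t f M → WindowSum t g N →
  WindowSum t (λ x → sumFrom (λ y → f x * g y) x t) (M * N)
windowSum-product {t} {f} {g} {M} {N} v w .total s = begin
  sumFrom (λ x → sumFrom (λ y → f x * g y) x t) s t ≡⟨ sumFrom-cong inner s t ⟩
  sumFrom (λ x → f x * N) s t                       ≡⟨ sumFrom-*ʳ N f s t ⟩
  sumFrom f s t * N                                 ≡⟨ cong (_* N) (v .total s) ⟩
  M * N                                             ∎
  where
  open ≡-Reasoning
  inner : ∀ x → sumFrom (λ y → f x * g y) x t ≡ f x * N
  inner x = trans (sumFrom-*ˡ (f x) g x t) (cong (f x *_) (w .total x))

-- Rainbow selections of pairwise non-consecutive positions

indicator : Bool → ℕ
indicator false = 0
indicator true  = 1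

NoConsecutive : (ℕ → Bool) → Set
NoConsecutive P = ∀ p → P p ≡ true → P (suc p) ≡ true → ⊥

Separated : ℕ → ℕ → Set
Separated p q = 2 + p ≤ q ⊎ 2 + q ≤ p

-- Distinctness of the positions is part of `separated`. All further restrictions on the positions
-- are carried by `R`.
record Selection {k : ℕ} (R : Fin k → ℕ → Set) (m : ℕ) : Set where
  field
    colour           : Fin m → Fin k
    position         : Fin m → ℕ
    colour-injective : Injective _≡_ _≡_ colour
    allowed          : ∀ a → R (colour a) (position a)
    separated        : ∀ {a b} → a ≢ b → Separated (position a) (position b)

open Selection

empty : ∀ {k} {R : Fin k → ℕ → Set} → Selection R 0
empty .colour ()
empty .position ()
empty .colour-injective {()}
empty .allowed ()
empty .separated {()}

weaken : ∀ {k m} {R R′ : Fin k → ℕ → Set} → (∀ {j q} → R′ j q → R j q) →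
  Selection R′ m → Selection R m
weaken R′⊆R S .colour           = S .colour
weaken R′⊆R S .position         = S .position
weaken R′⊆R S .colour-injective = S .colour-injective
weaken R′⊆R S .allowed a        = R′⊆R (S .allowed a)
weaken R′⊆R S .separated        = S .separated

-- `punchIn c` deletes the colour `c`, and separation from `p` is imposed on the remaining colours
-- through their relation, so nothing has to be rechecked after the recursive choice.
insert : ∀ {k m} {R : Fin (suc k) → ℕ → Set} c p → R c p →
  Selection (λ j q → R (punchIn c j) q × Separated p q) m → Selection R (suc m)
insert {k} {m} {R} c p Rcp S = record
  { colour = col ; position = pos ; colour-injective = inj _ _
  ; allowed = all ; separated = sep _ _ }
  where
  col : Fin (suc m) → Fin (suc k)
  col zero    = c
  col (suc a) = punchIn c (S .colour a)

  pos : Fin (suc m) → ℕ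
  pos zero    = p
  pos (suc a) = S .position a

  inj : ∀ a b → col a ≡ col b → a ≡ b
  inj zero    zero    _  = refl
  inj zero    (suc b) eq = contradiction (sym eq) (punchInᵢ≢i c _)
  inj (suc a) zero    eq = contradiction eq (punchInᵢ≢i c _)
  inj (suc a) (suc b) eq = cong suc (S .colour-injective (punchIn-injective c _ _ eq))

  all : ∀ a → R (col a) (pos a)
  all zero    = Rcp
  all (suc a) = proj₁ (S .allowed a)

  sep : ∀ a b → a ≢ b → Separated (pos a) (pos b)
  sep zero    zero    a≢b = contradiction refl a≢b
  sep zero    (suc b) _   = proj₂ (S .allowed b)
  sep (suc a) zero    _   = swap (proj₂ (S .allowed a))
  sep (suc a) (suc b) a≢b = S .separated (a≢b ∘ cong suc)

-- The remaining `m` colours come with an embedding `ι` and an equation `2 + m ≡ n`, so that it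
-- applies when `n` is a fixed variable; `i ≢ j` supplies the two colours to remove.
insert-two : ∀ {n} {R : Fin n → ℕ → Set} i j p q → i ≢ j → R i p → R j q → Separated p q →
  (∀ {m} (ι : Fin m → Fin n) → 2 + m ≡ n →
    Selection (λ l r → (R (ι l) r × Separated p r) × Separated q r) m) →
  Selection R n
insert-two {suc zero} zero zero p q i≢j _ _ _ _ = contradiction refl i≢j
insert-two {suc (suc m)} {R} i j p q i≢j Rip Rjq sep rest =
  insert i p Rip (insert (punchOut i≢j) q
    (subst (λ l → R l q) (sym (punchIn-punchOut i≢j)) Rjq , sep)
    (rest (punchIn i ∘ punchIn (punchOut i≢j)) refl))

consecutive≤1 : ∀ {P} → NoConsecutive P → ∀ p → indicator (P p) + indicator (P (suc p)) ≤ 1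
consecutive≤1 {P} nc p with P p in eq | P (suc p) in eq′
... | false | false = z≤n
... | false | true  = ≤-refl
... | true  | false = ≤-refl
... | true  | true  = ⊥-elim (nc p eq eq′)

indicator≤1 : ∀ b → indicator b ≤ 1
indicator≤1 false = z≤n
indicator≤1 true  = ≤-refl

-- The first occurring position s costs every other colour at most one position,
-- as no colour contains both s and s + 1.
greedy : ∀ T s {k} (P : Fin k → ℕ → Bool) → (∀ j → NoConsecutive (P j)) →
  (∀ j → k ≤ sumFrom (indicator ∘ P j) s T) →
  Selection (λ j q → P j q ≡ true × s ≤ q × q < s + T) k
greedy T       s {zero}  P nc many = empty
greedy zero    s {suc k} P nc many = contradiction (many zero) λ ()
greedy (suc T) s {suc k} P nc many with any? (λ j → P j s ≟ᵇ true)
... | no none = weaken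
  (λ (Pq , s<q , q<hi) → Pq , <⇒≤ s<q , ≤-trans q<hi (≤-reflexive (sym (+-suc s T))))
  (greedy T (suc s) P nc λ j → subst (suc k ≤_) (skip j) (many j))
  where
  skip : ∀ j → indicator (P j s) + sumFrom (indicator ∘ P j) (suc s) T ≡ sumFrom (indicator ∘ P j) (suc s) T
  skip j with P j s in eq
  ... | false = refl
  ... | true  = contradiction (j , eq) none
-- Windows of length 1 are treated apart, since the recursive choice discards two positions.
greedy (suc zero) s {suc zero} P nc many | yes (c , Pcs) =
  insert c s (Pcs , ≤-refl , m<m+n s (s≤s z≤n)) empty
greedy (suc zero) s {suc (suc k)} P nc many | yes _ =
  contradiction (≤-trans (many zero) (≤-trans (≤-reflexive (+-identityʳ _)) (indicator≤1 (P zero s))))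
                λ { (s≤s ()) }
greedy (suc (suc T)) s {suc k} P nc many | yes (c , Pcs) =
  insert c s (Pcs , ≤-refl , m<m+n s (s≤s z≤n))
    (weaken (λ (Pq , s+2≤q , q<hi) →
              (Pq , ≤-trans (m≤n+m s 2) s+2≤q , ≤-trans q<hi (≤-reflexive shift)) , inj₁ s+2≤q)
      (greedy T (2 + s) (P ∘ punchIn c) (nc ∘ punchIn c) (remaining ∘ punchIn c)))
  where
  shift : 2 + s + T ≡ s + (2 + T)
  shift = trans (cong suc (sym (+-suc s T))) (sym (+-suc s (suc T)))

  remaining : ∀ j → k ≤ sumFrom (indicator ∘ P j) (2 + s) T
  remaining j = s≤s⁻¹ (≤-trans (many j)
    (≤-trans (≤-reflexive (sym (+-assoc (indicator (P j s)) _ _)))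
             (+-monoˡ-≤ _ (consecutive≤1 (nc j) s))))

-- Deleting a closed neighbourhood from a set of positions

infixl 6 _∖_

_∖_ : (ℕ → Bool) → ℕ → ℕ → Bool
(P ∖ z) p with p ≟ z
... | yes _ = false
... | no  _ = P p

∖⁻ : ∀ P z p → (P ∖ z) p ≡ true → P p ≡ true × p ≢ z
∖⁻ P z p eq with p ≟ z
... | no p≢z = eq , p≢z

≢⇒∖ : ∀ P {z p} → p ≢ z → (P ∖ z) p ≡ P p
≢⇒∖ P {z} {p} p≢z with p ≟ z
... | yes p≡z = contradiction p≡z p≢z
... | no  _   = refl

sumFrom-∖-above : ∀ P z s T → z < s →
  sumFrom (indicator ∘ P) s T ≡ sumFrom (indicator ∘ (P ∖ z)) s T
sumFrom-∖-above P z s zero    z<s = refl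
sumFrom-∖-above P z s (suc T) z<s = cong₂ _+_
  (cong indicator (sym (≢⇒∖ P (>⇒≢ z<s)))) (sumFrom-∖-above P z (suc s) T (m<n⇒m<1+n z<s))

-- An inequality rather than an equation, because `z` may lie outside the window.
sumFrom-∖ : ∀ P z s T →
  sumFrom (indicator ∘ P) s T ≤ indicator (P z) + sumFrom (indicator ∘ (P ∖ z)) s T
sumFrom-∖ P z s zero    = z≤n
sumFrom-∖ P z s (suc T) with s ≟ z
... | yes refl = ≤-reflexive (cong (indicator (P s) +_) (sumFrom-∖-above P s (suc s) T ≤-refl))
... | no  _    = ≤-trans
  (+-monoʳ-≤ (indicator (P s)) (sumFrom-∖ P z (suc s) T))
  (≤-reflexive (exchange (indicator (P s)) (indicator (P z)) _))
  where
  exchange : ∀ a b c → a + (b + c) ≡ b + (a + c)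
  exchange = solve-∀

-- The sum over the closed neighbourhood of `1 + x`, indexed by its leftmost point.
around : (ℕ → ℕ) → ℕ → ℕ
around f x = f x + (f (1 + x) + f (2 + x))

around≤2 : ∀ {P} → NoConsecutive P → ∀ x → around (indicator ∘ P) x ≤ 2
around≤2 {P} nc x = ≤-trans
  (≤-reflexive (sym (+-assoc (indicator (P x)) _ _)))
  (+-mono-≤ (consecutive≤1 nc x) (indicator≤1 (P (2 + x))))

+-group₃ : ∀ a b c d → a + (b + (c + d)) ≡ a + (b + c) + d
+-group₃ = solve-∀

∖-noConsecutive : ∀ {P} z → NoConsecutive P → NoConsecutive (P ∖ z)
∖-noConsecutive {P} z nc p Pp Psp = nc p (proj₁ (∖⁻ P z p Pp)) (proj₁ (∖⁻ P z (suc p) Psp))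

remove-around : (ℕ → Bool) → ℕ → ℕ → Bool
remove-around P y = P ∖ y ∖ (1 + y) ∖ (2 + y)

remove-around⁻ : ∀ P y q → remove-around P y q ≡ true → P q ≡ true × Separated (suc y) q
remove-around⁻ P y q h₂ with ∖⁻ (P ∖ y ∖ (1 + y)) (2 + y) q h₂
... | h₁ , q≢2+y with ∖⁻ (P ∖ y) (1 + y) q h₁
...   | h₀ , q≢1+y with ∖⁻ P y q h₀
...     | Pq , q≢y = Pq , sep
  where
  sep : Separated (suc y) q
  sep with ≤-total q y
  ... | inj₁ q≤y = inj₂ (s≤s (≤∧≢⇒< q≤y q≢y))
  ... | inj₂ y≤q = inj₁
    (≤∧≢⇒< (≤∧≢⇒< (≤∧≢⇒< y≤q (≢-sym q≢y)) (≢-sym q≢1+y)) (≢-sym q≢2+y))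

sumFrom-remove-around : ∀ P y s T → sumFrom (indicator ∘ P) s T ≤
  around (indicator ∘ P) y + sumFrom (indicator ∘ remove-around P y) s T
sumFrom-remove-around P y s T = begin
  sumFrom (indicator ∘ P) s T
    ≤⟨ sumFrom-∖ P y s T ⟩
  b₀ + sumFrom (indicator ∘ (P ∖ y)) s T
    ≤⟨ +-monoʳ-≤ b₀ (sumFrom-∖ (P ∖ y) (1 + y) s T) ⟩
  b₀ + (indicator ((P ∖ y) (1 + y)) + sumFrom (indicator ∘ (P ∖ y ∖ (1 + y))) s T)
    ≤⟨ +-monoʳ-≤ b₀ (+-monoʳ-≤ (indicator ((P ∖ y) (1 + y))) (sumFrom-∖ (P ∖ y ∖ (1 + y)) (2 + y) s T)) ⟩
  b₀ + (indicator ((P ∖ y) (1 + y)) + (indicator ((P ∖ y ∖ (1 + y)) (2 + y)) + rest))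
    -- The three deleted positions differ, so the earlier deletions do not change the values of `P`
    -- read here.
    ≡⟨ cong₂ (λ b c → b₀ + (indicator b + (indicator c + rest)))
         (≢⇒∖ P 1+n≢n)
         (trans (≢⇒∖ (P ∖ y) 1+n≢n) (≢⇒∖ P (>⇒≢ (m<n⇒m<1+n ≤-refl)))) ⟩
  b₀ + (b₁ + (b₂ + rest))
    ≡⟨ +-group₃ b₀ b₁ b₂ rest ⟩
  b₀ + (b₁ + b₂) + rest ∎
  where
  open ≤-Reasoning
  b₀ = indicator (P y)
  b₁ = indicator (P (1 + y))
  b₂ = indicator (P (2 + y))
  rest = sumFrom (indicator ∘ remove-around P y) s T

-- Arithmetic of residues

module _ {t′ : ℕ} where
  private t = suc t′

  -- Equal remainders make `t` divide `d`, and no positive number below `t` is a multiple of it.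
  ≡%⇒≡ : ∀ {p d} → d < t → (p + d) % t ≡ p % t → d ≡ 0
  ≡%⇒≡ {p} {zero}  d<t eq = refl
  ≡%⇒≡ {p} {suc d} d<t eq = contradiction t∣d (>⇒∤ d<t)
    where
    open ≡-Reasoning
    t∣d : t ∣ suc d
    t∣d = ∣m+n∣m⇒∣n (divides ((p + suc d) / t) (+-cancelˡ-≡ (p % t) _ _ (begin
        p % t + (p / t * t + suc d)                 ≡⟨ +-assoc (p % t) _ _ ⟨
        p % t + p / t * t + suc d                   ≡⟨ cong (_+ suc d) (m≡m%n+[m/n]*n p t) ⟨
        p + suc d                                   ≡⟨ m≡m%n+[m/n]*n (p + suc d) t ⟩
        (p + suc d) % t + (p + suc d) / t * t       ≡⟨ cong (_+ (p + suc d) / t * t) eq ⟩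
        p % t + (p + suc d) / t * t                 ∎)))
      (divides (p / t) refl)

  %-injective-ordered : ∀ {w p q} → w ≤ p → p ≤ q → q < w + t → p % t ≡ q % t → p ≡ q
  %-injective-ordered {w} {p} {q} w≤p p≤q q<w+t eq with m≤n⇒∃[o]m+o≡n p≤q
  ... | d , refl = sym (trans (cong (p +_) (≡%⇒≡ {p} d<t (sym eq))) (+-identityʳ p))
    where
    d<t : d < t
    d<t = +-cancelˡ-< w d t (≤-<-trans (+-monoˡ-≤ d w≤p) q<w+t)

  %-injective-window : ∀ {w p q} → w ≤ p → p < w + t → w ≤ q → q < w + t → p % t ≡ q % t → p ≡ q
  %-injective-window {w} {p} {q} w≤p p<hi w≤q q<hi eq with ≤-total p q
  ... | inj₁ p≤q = %-injective-ordered w≤p p≤q q<hi eq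
  ... | inj₂ q≤p = sym (%-injective-ordered w≤q q≤p p<hi (sym eq))

  suc-% : ∀ p → suc p % t ≡ suc (p % t) % t
  suc-% p = trans (cong (λ q → suc q % t) (m≡m%n+[m/n]*n p t)) ([m+kn]%n≡m%n (suc (p % t)) (p / t) t)

  toℕ-mod : ∀ p → toℕ (p mod t) ≡ p % t
  toℕ-mod p = toℕ-fromℕ< (m%n<n p t)

  mod-periodic : ∀ p → (p + t) mod t ≡ p mod t
  mod-periodic p = fromℕ<-cong _ _ ([m+n]%n≡m%n p t) _ _

  mod-toℕ : ∀ (i : Fin t) → toℕ i mod t ≡ i
  mod-toℕ i = trans (fromℕ<-cong _ _ (m<n⇒m%n≡m (toℕ<n i)) _ (toℕ<n i)) (fromℕ<-toℕ i (toℕ<n i))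

  mod-cycleSucc : ∀ p → CycleSucc (p mod t) (suc p mod t)
  mod-cycleSucc p rewrite toℕ-mod p | toℕ-mod (suc p) with m≤n⇒m<n∨m≡n (m%n<n p t)
  ... | inj₁ lt = inj₁ (lt , trans (suc-% p) (m<n⇒m%n≡m lt))
  ... | inj₂ eq = inj₂ (eq , trans (suc-% p) (trans (cong (_% t) eq) (n%n≡0 t)))

  -- Both cases of `CycleSucc`, including the edge that closes the cycle, become a single
  -- congruence.
  cycleSucc⇒% : ∀ {p q} → CycleSucc (p mod t) (q mod t) → suc p % t ≡ q % t
  cycleSucc⇒% {p} {q} adj rewrite toℕ-mod p | toℕ-mod q with adj
  ... | inj₁ (lt , eq) = trans (suc-% p) (trans (m<n⇒m%n≡m lt) (sym eq))
  ... | inj₂ (eq , eq0) = trans (suc-% p) (trans (cong (_% t) eq) (trans (n%n≡0 t) (sym eq0)))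

separated⇒≢ : ∀ {p q} → Separated p q → p ≢ q
separated⇒≢ (inj₁ lt) refl = <⇒≱ lt (n≤1+n _)
separated⇒≢ (inj₂ lt) refl = <⇒≱ lt (n≤1+n _)

separated⇒suc≢ : ∀ {p q} → Separated p q → suc p ≢ q
separated⇒suc≢ (inj₁ lt) refl = <⇒≱ lt ≤-refl
separated⇒suc≢ (inj₂ lt) refl = <⇒≱ lt (≤-trans (n≤1+n _) (n≤1+n _))

-- The offset `s` is general so that the induction can pass to the tail of `S`.
sumFrom-subset : ∀ {t} (S : Subset t) f s → (∀ i → f (toℕ i + s) ≡ lookup S i) →
  sumFrom (indicator ∘ f) s t ≡ ∣ S ∣
sumFrom-subset []          f s eq = refl
sumFrom-subset (b ∷ S) f s eq with f s | eq zero
  | sumFrom-subset S f (suc s) (λ i → trans (cong f (+-suc (toℕ i) s)) (eq (suc i)))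
sumFrom-subset (true  ∷ S) f s eq | _ | refl | ih = cong suc ih
sumFrom-subset (false ∷ S) f s eq | _ | refl | ih = ih

-- Either one number is 0 and the other at most 2, or both are 1.
sum≤2-of-product≤1 : ∀ a b → a ≤ 2 → b ≤ 2 → a * b ≤ 1 → a + b ≤ 2
sum≤2-of-product≤1 0 b _ b≤2 _ = b≤2
sum≤2-of-product≤1 1 b _ _ ab≤1 = s≤s (subst (_≤ 1) (+-identityʳ b) ab≤1)
sum≤2-of-product≤1 2 0 _ _ _ = ≤-refl
sum≤2-of-product≤1 2 (suc b) _ _ (s≤s h) = contradiction (≤-trans (m≤n+m (suc (b + 0)) b) h) λ ()
sum≤2-of-product≤1 (suc (suc (suc a))) b (s≤s (s≤s ())) _ _

-- The given sets, unrolled along the integers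

module _ {t′ n : ℕ} (F : Fin n → Subset (suc t′))
         (independent : ∀ j → IndependentNSet (Cycle (suc t′)) n (F j)) where
  private t = suc t′

  -- A `t`-periodic copy of `F j` on ℕ: neighbourhoods and windows may run past `t` without a case
  -- distinction.
  occurs : Fin n → ℕ → Bool
  occurs j p = lookup (F j) (p mod t)

  occurrences : Fin n → ℕ → ℕ
  occurrences j = indicator ∘ occurs j

  occurs-noConsecutive : ∀ j → NoConsecutive (occurs j)
  occurs-noConsecutive j p here-p here-sp = proj₁ (independent j) _ _
    (lookup⇒[]= _ _ here-p) (lookup⇒[]= _ _ here-sp) (inj₁ (mod-cycleSucc p))

  occurrences-windowSum : ∀ j → WindowSum t (occurrences j) n
  occurrences-windowSum j .total s = begin
    sumFrom (occurrences j) s t ≡⟨ sumFrom-periodic (occurrences j) t periodic s ⟩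
    sumFrom (occurrences j) 0 t ≡⟨ sumFrom-subset (F j) (occurs j) 0 vertices ⟩
    ∣ F j ∣                     ≡⟨ proj₂ (independent j) ⟩
    n                           ∎
    where
    open ≡-Reasoning
    periodic : ∀ p → occurrences j (p + t) ≡ occurrences j p
    periodic p = cong (indicator ∘ lookup (F j)) (mod-periodic p)
    vertices : ∀ i → occurs j (toℕ i + 0) ≡ lookup (F j) i
    vertices i = cong (lookup (F j)) (trans (cong (_mod t) (+-identityʳ (toℕ i))) (mod-toℕ i))

  -- Positions range over t − 1 consecutive integers, so that the edge closing the cycle plays no role.
  Available : ℕ → Fin n → ℕ → Set
  Available w j q = occurs j q ≡ true × w ≤ q × suc q < w + t

  -- Congruent numbers in a window of length `t` are equal. Applied to `pos a` and `pos b` this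
  -- gives distinct vertices, applied to `suc (pos a)` and `pos b` it excludes edges.
  selection⇒rainbow : ∀ {w m} → Selection (Available w) m → HasRainbowIndependent (Cycle t) F m
  selection⇒rainbow {w} {m} S =
    S .colour , vertex , S .colour-injective , vertex-injective ,
    (λ a → lookup⇒[]= _ _ (proj₁ (S .allowed a))) ,
    λ a b → [ notSucc a b , notSucc b a ]′
    where
    pos = S .position
    vertex : Fin m → Fin t
    vertex a = pos a mod t

    lower : ∀ a → w ≤ pos a
    lower a = proj₁ (proj₂ (S .allowed a))

    upper : ∀ a → suc (pos a) < w + t
    upper a = proj₂ (proj₂ (S .allowed a))

    vertex-injective : Injective _≡_ _≡_ vertex
    vertex-injective {a} {b} eq with a ≟ᶠ b
    ... | yes a≡b = a≡b
    ... | no  a≢b = contradiction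
      (%-injective-window (lower a) (<⇒≤ (upper a)) (lower b) (<⇒≤ (upper b))
        (trans (sym (toℕ-mod (pos a))) (trans (cong toℕ eq) (toℕ-mod (pos b)))))
      (separated⇒≢ (S .separated a≢b))

    notSucc : ∀ a b → ¬ CycleSucc (vertex a) (vertex b)
    notSucc a b adj with %-injective-window (m≤n⇒m≤1+n (lower a)) (upper a) (lower b) (<⇒≤ (upper b))
                           (cycleSucc⇒% {p = pos a} {q = pos b} adj)
    ... | eq with a ≟ᶠ b
    ...   | yes refl = contradiction eq 1+n≢n
    ...   | no  a≢b  = separated⇒suc≢ (S .separated a≢b) eq

  -- The `t′` positions following `v` form a path that still contains all `n` elements of every set.
  uncovered⇒rainbow : ∀ v → (∀ j → occurs j v ≢ true) → HasRainbowIndependent (Cycle t) F n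
  uncovered⇒rainbow v unc = selection⇒rainbow {w = suc v} (weaken
    (λ {j} {q} (occ , v<q , q<hi) → occ , v<q , s≤s (subst (q <_) (sym (+-suc v t′)) q<hi))
    (greedy t′ (suc v) occurs occurs-noConsecutive λ j → ≤-reflexive (sym (rest j))))
    where
    rest : ∀ j → sumFrom (occurrences j) (suc v) t′ ≡ n
    rest j with occurs j v in eq | occurrences-windowSum j .total v
    ... | false | sum≡n = sum≡n
    ... | true  | _     = contradiction eq (unc j)

  occurs⇒1≤ : ∀ j p → occurs j p ≡ true → 1 ≤ occurrences j p
  occurs⇒1≤ j p occ = ≤-reflexive (sym (cong indicator occ))

  -- The pair (x , y) stands for the centres x + 1 and y + 1, which avoids subtraction.
  nearby : Fin n → ℕ → ℕ
  nearby j = around (occurrences j)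

  shared : Fin n → ℕ → ℕ → ℕ
  shared j x y = occurrences j (suc x) * occurrences j (suc y)

  -- The part of the weight due to the set `j`. The two copies of `shared` alone amount to 2 when
  -- the set contains both centres.
  conflict : ℕ → ℕ → Fin n → ℕ
  conflict x y j = nearby j x * nearby j y + (shared j x y + shared j x y)

  shared⇒2≤conflict : ∀ {x y} j → occurs j (suc x) ≡ true → occurs j (suc y) ≡ true →
    2 ≤ conflict x y j
  shared⇒2≤conflict {x} {y} j occ occ′ = ≤-trans
    (+-mono-≤ 1≤shared 1≤shared) (m≤n+m _ (nearby j x * nearby j y))
    where
    1≤shared : 1 ≤ shared j x y
    1≤shared = *-mono-≤ (occurs⇒1≤ j (suc x) occ) (occurs⇒1≤ j (suc y) occ′)

  nearby⇒1≤conflict : ∀ {x y} j → 1 ≤ nearby j x → 1 ≤ nearby j y → 1 ≤ conflict x y j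
  nearby⇒1≤conflict j jx jy = ≤-trans (*-mono-≤ jx jy) (m≤m+n _ _)

  nearby₀ : ∀ j x → occurs j x ≡ true → 1 ≤ nearby j x
  nearby₀ j x occ = ≤-trans (occurs⇒1≤ j x occ) (m≤m+n _ _)

  nearby₁ : ∀ j x → occurs j (1 + x) ≡ true → 1 ≤ nearby j x
  nearby₁ j x occ = ≤-trans (occurs⇒1≤ j (1 + x) occ) (≤-trans (m≤m+n _ _) (m≤n+m _ (occurrences j x)))

  nearby₂ : ∀ j x → occurs j (2 + x) ≡ true → 1 ≤ nearby j x
  nearby₂ j x occ = ≤-trans (occurs⇒1≤ j (2 + x) occ)
    (≤-trans (m≤n+m _ (occurrences j (1 + x))) (m≤n+m _ (occurrences j x)))

  -- Pairs of centres of weight at most 1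

  module _ {x y : ℕ} (x≤y : x ≤ y) (y<x+t : y < x + t) (calm : sum (conflict x y) < 2)
           {i j : Fin n} (i-at-x : occurs i (suc x) ≡ true) (j-at-y : occurs j (suc y) ≡ true) where

    i≢j : i ≢ j
    i≢j refl = <⇒≱ calm (≤-trans (shared⇒2≤conflict {x} {y} i i-at-x j-at-y) (term≤sum (conflict x y) i))

    -- Each of `i` and `j` would meet both neighbourhoods, and two distinct sets would contribute at
    -- least 1 each.
    not-both-near : ¬ (1 ≤ nearby i y × 1 ≤ nearby j x)
    not-both-near (iy , jx) = <⇒≱ calm (≤-trans
      (+-mono-≤ (nearby⇒1≤conflict {x} {y} i (nearby₁ i x i-at-x) iy)
                (nearby⇒1≤conflict {x} {y} j jx (nearby₁ j y j-at-y)))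
      (two-terms≤sum (conflict x y) i≢j))

    -- If the centres coincided or were adjacent, each would lie in the closed neighbourhood of the
    -- other.
    x+2≤y : 2 + x ≤ y
    x+2≤y = ≤∧≢⇒< (≤∧≢⇒< x≤y x≢y) x+1≢y
      where
      x≢y : x ≢ y
      x≢y refl = not-both-near (nearby₁ i x i-at-x , nearby₁ j x j-at-y)
      x+1≢y : 1 + x ≢ y
      x+1≢y refl = not-both-near (nearby₀ i (1 + x) i-at-x , nearby₂ j x j-at-y)

    -- Adjacency around the other side of the cycle: were `1 + y` equal to `x + t`, the centre
    -- `1 + x` would recur one period later as `2 + y`.
    y+1<x+t : 1 + y < x + t
    y+1<x+t = ≤∧≢⇒< y<x+t λ eq → not-both-near
      ( nearby₂ i y (trans (cong (λ p → occurs i (suc p)) eq)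
          (trans (cong (lookup (F i)) (mod-periodic (suc x))) i-at-x))
      , nearby₀ j x (trans (sym (cong (lookup (F j)) (mod-periodic x)))
          (trans (cong (occurs j) (sym eq)) j-at-y)))

    nearby-sum≤2 : ∀ l → nearby l x + nearby l y ≤ 2
    nearby-sum≤2 l = sum≤2-of-product≤1 (nearby l x) (nearby l y)
      (around≤2 (occurs-noConsecutive l) x) (around≤2 (occurs-noConsecutive l) y)
      (≤-trans (m≤m+n _ _) (≤-trans (term≤sum (conflict x y) l) (s≤s⁻¹ calm)))

    -- Set `i` takes `1 + x` and set `j` takes `1 + y`. Removing the neighbourhood of `1 + x` cuts
    -- the cycle to a path of `r` positions from `3 + x` on; the neighbourhood of `1 + y` is deleted
    -- from the other sets before the greedy choice.
    calm-pair⇒rainbow : HasRainbowIndependent (Cycle t) F n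
    calm-pair⇒rainbow with m≤n⇒∃[o]m+o≡n {3} {t}
      (<⇒≤ (+-cancelˡ-< x 3 t (≤-<-trans (≤-trans (≤-reflexive (+-comm x 3)) (s≤s x+2≤y)) y+1<x+t)))
    ... | r , 3+r≡t = selection⇒rainbow {w = suc x}
      (insert-two i j (suc x) (suc y) i≢j
        (i-at-x , ≤-refl , s≤s (≤-<-trans (≤-trans (n≤1+n _) (≤-trans x+2≤y (n≤1+n _))) y+1<x+t))
        (j-at-y , s≤s x≤y , s≤s y+1<x+t)
        (inj₁ (s≤s x+2≤y))
        λ {m} ι 2+m≡n → weaken
          (λ {l} {q} (free , 3+x≤q , q<hi) → let occ , sep = remove-around⁻ (occurs (ι l)) y q free in
            ((occ , ≤-trans (m≤n+m (suc x) 2) 3+x≤q , s≤s (≤-trans q<hi (≤-reflexive window-end)))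
            -- `3 + x ≤ q` is exactly separation from the position `1 + x`.
            , inj₁ 3+x≤q) , sep)
          (greedy r (3 + x) (λ l → remove-around (occurs (ι l)) y)
            (λ l → ∖-noConsecutive (2 + y) (∖-noConsecutive (1 + y) (∖-noConsecutive y (occurs-noConsecutive (ι l)))))
            (λ l → many m 2+m≡n (ι l))))
      where
      window-end : 3 + x + r ≡ x + t
      window-end = trans (cong (_+ r) (+-comm 3 x)) (trans (+-assoc x 3 r) (cong (x +_) 3+r≡t))

      many : ∀ m → 2 + m ≡ n → ∀ l → m ≤ sumFrom (indicator ∘ remove-around (occurs l) y) (3 + x) r
      many m 2+m≡n l = +-cancelˡ-≤ 2 _ _ (begin
        2 + m                                          ≡⟨ 2+m≡n ⟩
        n                                              ≡⟨ occurrences-windowSum l .total x ⟨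
        sumFrom (occurrences l) x t                    ≡⟨ cong (sumFrom (occurrences l) x) 3+r≡t ⟨
        sumFrom (occurrences l) x (3 + r)              ≡⟨ +-group₃ (occurrences l x) (occurrences l (1 + x)) (occurrences l (2 + x)) _ ⟩
        nearby l x + sumFrom (occurrences l) (3 + x) r ≤⟨ +-monoʳ-≤ (nearby l x) (sumFrom-remove-around (occurs l) y (3 + x) r) ⟩
        nearby l x + (nearby l y + rest)               ≡⟨ +-assoc (nearby l x) (nearby l y) rest ⟨
        nearby l x + nearby l y + rest                 ≤⟨ +-monoˡ-≤ rest (nearby-sum≤2 l) ⟩
        2 + rest                                       ∎)
        where
        open ≤-Reasoning
        rest = sumFrom (indicator ∘ remove-around (occurs l) y) (3 + x) r

  -- Double counting of the weights

  totalConflict : ℕ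
  -- Starting the inner window at `x` counts each ordered pair of vertices once and ensures
  -- `x ≤ y < x + t`.
  totalConflict = sumFrom (λ x → sumFrom (λ y → sum (conflict x y)) x t) 0 t

  -- After exchanging the sums, each set contributes (3n)² + 2n²: each of its `n` elements lies in
  -- three closed neighbourhoods.
  totalConflict≡ : totalConflict ≡ n * (11 * (n * n))
  totalConflict≡ = begin
    totalConflict
      ≡⟨ sumFrom-cong (λ x → sumFrom-sum (conflict x) x t) 0 t ⟩
    sumFrom (λ x → sum (λ j → sumFrom (λ y → conflict x y j) x t)) 0 t
      ≡⟨ sumFrom-sum (λ x j → sumFrom (λ y → conflict x y j) x t) 0 t ⟩
    sum (λ j → sumFrom (λ x → sumFrom (λ y → conflict x y j) x t) 0 t)
      ≡⟨ sum-const _ (11 * (n * n)) conflict-of-colour ⟩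
    n * (11 * (n * n)) ∎
    where
    open ≡-Reasoning
    conflict-of-colour : ∀ j → sumFrom (λ x → sumFrom (λ y → conflict x y j) x t) 0 t ≡ 11 * (n * n)
    conflict-of-colour j = begin
      sumFrom (λ x → sumFrom (λ y → conflict x y j) x t) 0 t
        ≡⟨ sumFrom-cong (λ x → trans (sumFrom-+ (λ y → nearby j x * nearby j y) _ x t)
             (cong (sumFrom (λ y → nearby j x * nearby j y) x t +_) (sumFrom-+ (shared j x) (shared j x) x t))) 0 t ⟩
      sumFrom (λ x → sumFrom (λ y → nearby j x * nearby j y) x t
                   + (sumFrom (shared j x) x t + sumFrom (shared j x) x t)) 0 t
        ≡⟨ (windowSum-+ (windowSum-product nearby-sum nearby-sum) (windowSum-+ shared-sum shared-sum)) .total 0 ⟩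
      (n + (n + n)) * (n + (n + n)) + (n * n + n * n)
        ≡⟨ collect n ⟩
      11 * (n * n) ∎
      where
      once : WindowSum t (occurrences j) n
      once = occurrences-windowSum j
      shift₁ : WindowSum t (λ x → occurrences j (1 + x)) n
      shift₁ = windowSum-shift once
      shift₂ : WindowSum t (λ x → occurrences j (2 + x)) n
      shift₂ = windowSum-shift shift₁
      nearby-sum : WindowSum t (nearby j) (n + (n + n))
      nearby-sum = windowSum-+ once (windowSum-+ shift₁ shift₂)
      shared-sum : WindowSum t (λ x → sumFrom (shared j x) x t) (n * n)
      shared-sum = windowSum-product shift₁ shift₁
      collect : ∀ a → (a + (a + a)) * (a + (a + a)) + (a * a + a * a) ≡ 11 * (a * a)
      collect = solve-∀

  rainbow : n * (11 * (n * n)) < t * (t * 2) → HasRainbowIndependent (Cycle t) F n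
  rainbow sparse
    -- Averaging twice: some row has sum below `t * 2`, and some entry of that row is below 2.
    with sumFrom<⇒∃< _ _ 0 t (subst (_< t * (t * 2)) (sym totalConflict≡) sparse)
  ... | x , _ , _ , row<2t with sumFrom<⇒∃< _ _ x t row<2t
  ...   | y , x≤y , y<x+t , calm
      with any? (λ i → occurs i (suc x) ≟ᵇ true) | any? (λ j → occurs j (suc y) ≟ᵇ true)
  ...     | no none       | _             = uncovered⇒rainbow (suc x) λ i occ → none (i , occ)
  ...     | yes _         | no none       = uncovered⇒rainbow (suc y) λ j occ → none (j , occ)
  ...     | yes (i , occ) | yes (j , occ′) = calm-pair⇒rainbow x≤y y<x+t calm occ occ′

-- From the length hypothesis to the counting bound

4ab≤[a+b]² : ∀ a b → 4 * (a * b) ≤ (a + b) * (a + b)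
4ab≤[a+b]² a b with ≤-total a b
-- The gap between the two sides is the square of the difference `d`; the case split on the order
-- avoids subtraction.
... | inj₁ a≤b with m≤n⇒∃[o]m+o≡n a≤b
...   | d , refl = ≤-trans (m≤m+n _ (d * d)) (≤-reflexive (square a d))
  where
  square : ∀ a d → 4 * (a * (a + d)) + d * d ≡ (a + (a + d)) * (a + (a + d))
  square = solve-∀
4ab≤[a+b]² a b | inj₂ b≤a with m≤n⇒∃[o]m+o≡n b≤a
...   | d , refl = ≤-trans (m≤m+n _ (d * d)) (≤-reflexive (square b d))
  where
  square : ∀ b d → 4 * ((b + d) * b) + d * d ≡ (b + d + b) * (b + d + b)
  square = solve-∀

-- AM–GM on 3n and 44 gives 528 n³ ≤ (3n² + 44n)² < 81 t², while 81 · 11 ≤ 2 · 528.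
long-cycle⇒sparse : ∀ n t → 3 * (n * n) + 44 * n < 9 * t → n * (11 * (n * n)) < t * (t * 2)
long-cycle⇒sparse n t long = *-cancelˡ-< 81 _ _ (begin-strict
  81 * (n * (11 * (n * n)))                     ≡⟨ e₁ n ⟩
  891 * (n * (n * n))                           ≤⟨ *-monoˡ-≤ (n * (n * n)) (m≤m+n 891 165) ⟩
  1056 * (n * (n * n))                          ≡⟨ e₂ n ⟩
  2 * (n * n * (4 * (3 * n * 44)))              ≤⟨ *-monoʳ-≤ 2 (*-monoʳ-≤ (n * n) (4ab≤[a+b]² (3 * n) 44)) ⟩
  2 * (n * n * ((3 * n + 44) * (3 * n + 44)))   ≡⟨ e₃ n ⟩
  2 * ((3 * (n * n) + 44 * n) * (3 * (n * n) + 44 * n)) <⟨ *-monoʳ-< 2 (*-mono-< long long) ⟩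
  2 * (9 * t * (9 * t))                         ≡⟨ e₄ t ⟩
  81 * (t * (t * 2))                            ∎)
  where
  open ≤-Reasoning
  e₁ : ∀ n → 81 * (n * (11 * (n * n))) ≡ 891 * (n * (n * n))
  e₁ = solve-∀
  e₂ : ∀ n → 1056 * (n * (n * n)) ≡ 2 * (n * n * (4 * (3 * n * 44)))
  e₂ = solve-∀
  e₃ : ∀ n → 2 * (n * n * ((3 * n + 44) * (3 * n + 44))) ≡ 2 * ((3 * (n * n) + 44 * n) * (3 * (n * n) + 44 * n))
  e₃ = solve-∀
  e₄ : ∀ t → 2 * (9 * t * (9 * t)) ≡ 81 * (t * (t * 2))
  e₄ = solve-∀

-- Fewer than n sets do not suffice

evens : ∀ (n t : ℕ) → Subset t
evens zero    t             = ∅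
-- This case and the next are default values, which do not arise when `n * 2 ≤ t`.
evens (suc n) zero          = []
evens (suc n) (suc zero)    = false ∷ []
evens (suc n) (suc (suc t)) = true ∷ false ∷ evens n t

∣evens∣ : ∀ n t → n * 2 ≤ t → ∣ evens n t ∣ ≡ n
∣evens∣ zero    t             _                = ∣⊥∣≡0 t
∣evens∣ (suc n) (suc (suc t)) (s≤s (s≤s 2n≤t)) = cong suc (∣evens∣ n t 2n≤t)

∈evens⁻ : ∀ n t {i} → i ∈ evens n t → ∃ λ k → toℕ i ≡ k * 2 × k < n
∈evens⁻ zero    t             i∈              = contradiction i∈ ∉⊥
∈evens⁻ (suc n) (suc zero)    (there ())
∈evens⁻ (suc n) (suc (suc t)) here            = 0 , refl , s≤s z≤n
∈evens⁻ (suc n) (suc (suc t)) (there (there i∈)) with ∈evens⁻ n t i∈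
... | k , eq , k<n = suc k , cong (2 +_) eq , s≤s k<n

-- An inner edge joins numbers of different parity. The closing edge starts at `t − 1`, while every
-- element is at most 2n - 2.
evens-independent : ∀ n t → n * 2 ≤ t → Independent (Cycle t) (evens n t)
evens-independent n t 2n≤t i j i∈ j∈ = [ notSucc i∈ j∈ , notSucc j∈ i∈ ]′
  where
  notSucc : ∀ {i j} → i ∈ evens n t → j ∈ evens n t → ¬ CycleSucc i j
  notSucc i∈ j∈ adj with ∈evens⁻ n t i∈ | ∈evens⁻ n t j∈
  notSucc i∈ j∈ (inj₁ (_ , eq)) | k , i≡ , _ | l , j≡ , _ =
    even≢odd l k (trans (*-comm 2 l) (trans (sym j≡) (trans eq (cong suc (trans i≡ (*-comm k 2))))))
  notSucc i∈ j∈ (inj₂ (eq , _)) | k , i≡ , k<n | _ =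
    <⇒≱ (≤-trans (*-monoˡ-≤ 2 k<n) 2n≤t) (≤-reflexive (trans (sym eq) (cong suc i≡)))

-- A rainbow `n`-set needs `n` distinct indices out of `k`. The family of `k` equal sets shows that
-- the property is not vacuous.
few-sets-insufficient : ∀ {n t k} → n * 2 ≤ t → k < n → ¬ RainbowProperty (Cycle t) n n k
few-sets-insufficient {n} {t} 2n≤t k<n property
  with property (λ _ → evens n t) (λ _ → evens-independent n t 2n≤t , ∣evens∣ n t 2n≤t)
... | _ , _ , injective , _ = <⇒≱ k<n (injective⇒≤ injective)

theorem1p7 : (n t : ℕ) → 1 ≤ n → 1 ≤ t →
    3 * (n * n) + 44 * n < 9 * t →
    fEquals (Cycle t) n n n
theorem1p7 n t@(suc _) _ _ long =
  (λ F independent → rainbow F independent (long-cycle⇒sparse n t long)) ,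
  λ k k<n → few-sets-insufficient (*-cancelˡ-≤ 9 2n≤t) k<n
  where
  18n+26n : ∀ n → 9 * (n * 2) + 26 * n ≡ 44 * n
  18n+26n = solve-∀
  -- The term `44 * n` of the hypothesis exceeds 18n by 26n, which gives 2n ≤ t after division by 9.
  2n≤t : 9 * (n * 2) ≤ 9 * t
  2n≤t = ≤-trans (m≤m+n _ (26 * n)) (≤-trans (≤-reflexive (18n+26n n))
    (≤-trans (m≤n+m _ (3 * (n * n))) (<⇒≤ long)))
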